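{- The linear ordering $$(0)<(1)<\cdots<(n)<\cdots<(x-n)<\cdots<(x-2)<(x-1)$$ on the polynomial alphabet extends to a linear ordering on the positive polynomials of $\mathbb{Z}[x]$, and to one on $\mathbb{Z}[x]$ by symmetry: we have $$\begin{aligned}[][(0)]_x&<[(1)]_x<\cdots<[(x-1)]_x<[(1)(0)]_x\\&<[(1)(1)]_x<\cdots<[(1)(x-1)]_x<[(2)(0)]_x\\&\ \ \vdots\\&<[(x-2)(1)]_x<\cdots<[(x-2)(x-1)]_x<[(x-1)(0)]_x\\&<[(x-1)(1)]_x<\cdots<[(x-1)(x-1)]_x<[(1)(0)(0)]_x\\&<[(1)(0)(1)]_x<\cdots,\end{aligned}$$ i.e. positive polynomials are compared first by their number of base-$x$ digits (more digits is larger) and, when these numbers are equal, lexicographically by digits starting from the leading digit. Every polynomial in $\mathbb{Z}[x]$ has an immediate successor and an immediate predecessor in this ordering, obtained by adding, respectively subtracting, $[(1)]_x=1$.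
   Context: A polynomial $f\in\mathbb{Z}[x]$ is called positive if its leading coefficient is positive. The polynomial alphabet is the set of digits $\{0,1,2,\dots\}\cup\{x-1,x-2,\dots\}$. Every positive $f\in\mathbb{Z}[x]$ has a unique base-$x$ representation $f(x)=\sum_{i=0}^m b_i(x)x^i$ with digits $b_i(x)$ in the polynomial alphabet and $b_m(x)\ne 0$; it is written $f=[(b_m(x))\cdots(b_1(x))(b_0(x))]_x$ and has $m+1$ digits. The zero polynomial is $[(0)]_x$. Extension "by symmetry" means: $0$ is smaller than every positive polynomial, every $f$ with $-f$ positive is smaller than $0$ and than every positive polynomial, and for $-f,-g$ positive, $f<g$ if and only if $-g<-f$. -}

module Defs where

open import Data.Integer.Base as ℤ using (ℤ; +_; -[1+_]; 0ℤ; 1ℤ)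
open import Data.List.Base using (List; []; _∷_; _++_; length; map; replicate)
open import Data.List.Relation.Binary.Lex.Strict using (Lex-<)
open import Data.Nat.Base as ℕ using (ℕ; zero; suc)
open import Data.Product.Base using (Σ; ∃; ∃₂; _×_; _,_)
open import Data.Sum.Base using (_⊎_)
open import Relation.Binary.Core using (Rel)
open import Relation.Binary.PropositionalEquality.Core using (_≡_; _≢_)
open import Relation.Nullary.Negation.Core using (¬_)
open import Level using (0ℓ)

infix  4 _≈_ _≈⁺_ _<ᴰ_ _≺_ _<⁺_ _<_ _Represents_
infixl 6 _+ₚ_ _-ₚ_
infix  8 -ₚ_

-- Coefficient lists, constant term first.  Trailing zeros are allowed, so
-- equality of polynomials is _≈_ rather than _≡_.
ℤ[x] : Set
ℤ[x] = List ℤ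

coeff : ℤ[x] → ℕ → ℤ
coeff []       _       = 0ℤ
coeff (c ∷ _)  zero    = c
coeff (_ ∷ cs) (suc i) = coeff cs i

_≈_ : Rel ℤ[x] 0ℓ
f ≈ g = ∀ i → coeff f i ≡ coeff g i

0ₚ 1ₚ : ℤ[x]
0ₚ = []
1ₚ = 1ℤ ∷ []

_+ₚ_ : ℤ[x] → ℤ[x] → ℤ[x]
[]       +ₚ g        = g
(a ∷ f)  +ₚ []       = a ∷ f
(a ∷ f)  +ₚ (b ∷ g)  = (a ℤ.+ b) ∷ (f +ₚ g)

-ₚ_ : ℤ[x] → ℤ[x]
-ₚ f = map (λ c → ℤ.- c) f

_-ₚ_ : ℤ[x] → ℤ[x] → ℤ[x]
f -ₚ g = f +ₚ (-ₚ g)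

-- Multiplication by x ^ n.
shift : ℕ → ℤ[x] → ℤ[x]
shift n f = replicate n 0ℤ ++ f

record Positive (f : ℤ[x]) : Set where
  constructor mkPositive
  field
    degree    : ℕ
    leading>0 : 0ℤ ℤ.< coeff f degree
    above≡0   : ∀ i → degree ℕ.< i → coeff f i ≡ 0ℤ

ℤ[x]⁺ : Set
ℤ[x]⁺ = Σ ℤ[x] Positive

-- As with -[1+_] for integers, x-[1+ n ] stands for x - (1 + n).
data Digit : Set where
  const   : ℕ → Digit
  x-[1+_] : ℕ → Digit

⟦_⟧ : Digit → ℤ[x]
⟦ const n   ⟧ = + n ∷ []
⟦ x-[1+ n ] ⟧ = -[1+ n ] ∷ 1ℤ ∷ []

data _<ᴰ_ : Rel Digit 0ℓ where
  const<const : ∀ {m n} → m ℕ.< n → const m <ᴰ const n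
  const<x-    : ∀ {m n} → const m <ᴰ x-[1+ n ]
  x-<x-       : ∀ {m n} → n ℕ.< m → x-[1+ m ] <ᴰ x-[1+ n ]

-- Digit strings are written leading digit first:
-- [ bₘ ∷ … ∷ b₁ ∷ b₀ ∷ [] ]ₓ is the sum of the bᵢ x ^ i.
[_]ₓ : List Digit → ℤ[x]
[ []     ]ₓ = 0ₚ
[ b ∷ bs ]ₓ = shift (length bs) ⟦ b ⟧ +ₚ [ bs ]ₓ

data IsNumeral : List Digit → Set where
  zeroNumeral    : IsNumeral (const 0 ∷ [])
  nonzeroLeading : ∀ {b bs} → b ≢ const 0 → IsNumeral (b ∷ bs)

_Represents_ : List Digit → ℤ[x] → Set
bs Represents f = IsNumeral bs × [ bs ]ₓ ≈ f

_≺_ : Rel (List Digit) 0ℓ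
bs ≺ cs = length bs ℕ.< length cs
        ⊎ (length bs ≡ length cs × Lex-< _≡_ _<ᴰ_ bs cs)

_≈⁺_ : Rel ℤ[x]⁺ 0ℓ
(f , _) ≈⁺ (g , _) = f ≈ g

_<⁺_ : Rel ℤ[x]⁺ 0ℓ
(f , _) <⁺ (g , _) = ∃₂ λ bs cs → bs Represents f × cs Represents g × bs ≺ cs

data _<_ (f g : ℤ[x]) : Set where
  pos<pos   : (f⁺ : Positive f) (g⁺ : Positive g) → (f , f⁺) <⁺ (g , g⁺) → f < g
  zero<pos  : f ≈ 0ₚ → Positive g → f < g
  neg<zero  : Positive (-ₚ f) → g ≈ 0ₚ → f < g
  neg<pos   : Positive (-ₚ f) → Positive g → f < g
  neg<neg   : (f⁻ : Positive (-ₚ f)) (g⁻ : Positive (-ₚ g)) →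
              (-ₚ g , g⁻) <⁺ (-ₚ f , f⁻) → f < g

IsImmediateSuccessor : ℤ[x] → ℤ[x] → Set
IsImmediateSuccessor f g = f < g × ¬ (∃ λ h → f < h × h < g)

IsImmediatePredecessor : ℤ[x] → ℤ[x] → Set
IsImmediatePredecessor f g = g < f × ¬ (∃ λ h → g < h × h < f)

{-# OPTIONS --safe #-}

-- On ℤ[x] consider f <ₚ g iff g - f has positive leading coefficient.  This is a
-- discrete ordered group: trichotomy is the trichotomy of the sign of g - f, and
-- no h has both h and 1 - h positive.  Every string of k digits evaluates to
-- something below xᵏ, so a carry-free comparison of digit strings from the left
-- agrees with <ₚ; as every positive polynomial has a numeral (a negative constant
-- term borrows 1 from the next coefficient), both <⁺ and < coincide with <ₚ.
module Submission where

open import Defs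
open import Data.Integer.Base as ℤ using (ℤ; +_; -[1+_]; 0ℤ; 1ℤ)
import Data.Integer.Properties as ℤₚ
open import Data.Integer.Tactic.RingSolver using (solve-∀)
open import Data.List.Base using (List; []; _∷_; _++_; length)
open import Data.List.Properties using (length-++)
open import Data.List.Relation.Binary.Lex.Core using (Lex-<; this; next)
import Data.List.Relation.Binary.Lex.Strict as Lex
open import Data.List.Relation.Binary.Pointwise using (Pointwise-≡⇒≡)
open import Data.Nat.Base as ℕ using (ℕ; zero; suc; z≤n; s≤s)
import Data.Nat.Properties as ℕₚ
open import Data.Product.Base using (∃; _×_; _,_; proj₁)
open import Data.Sum.Base using (_⊎_; inj₁; inj₂)
open import Function.Base using (_∘_)
open import Function.Bundles using (_⇔_; mk⇔; Equivalence)
open import Function.Construct.Composition using (_⇔-∘_)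
open import Function.Construct.Symmetry using (⇔-sym)
open import Level using (0ℓ)
open import Relation.Binary.Construct.On using () renaming (isStrictTotalOrder to on-isStrictTotalOrder)
open import Relation.Binary.Core using (Rel)
open import Relation.Binary.Definitions using (tri<; tri≈; tri>; Transitive; Trichotomous)
open import Relation.Binary.PropositionalEquality.Core using (_≡_; _≢_; refl; sym; trans; cong; cong₂; subst)
open import Relation.Binary.PropositionalEquality.Properties using (isEquivalence)
open import Relation.Binary.Structures using (IsEquivalence; IsStrictTotalOrder)
open import Relation.Binary.Structures.Biased using (isStrictTotalOrderᶜ)
open import Relation.Nullary.Negation.Core using (¬_; contradiction)

infix 4 _<ₚ_

-- Coefficientwise arithmetic of polynomials

i<j⇒0<j-i : ∀ {i j} → i ℤ.< j → 0ℤ ℤ.< j ℤ.- i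
i<j⇒0<j-i {i} {j} i<j = subst (ℤ._< j ℤ.- i) (ℤₚ.+-inverseʳ i) (ℤₚ.+-monoˡ-< (ℤ.- i) i<j)

coeff-+ₚ : ∀ f g i → coeff (f +ₚ g) i ≡ coeff f i ℤ.+ coeff g i
coeff-+ₚ []      g       i       = sym (ℤₚ.+-identityˡ _)
coeff-+ₚ (a ∷ f) []      i       = sym (ℤₚ.+-identityʳ _)
coeff-+ₚ (a ∷ f) (b ∷ g) zero    = refl
coeff-+ₚ (a ∷ f) (b ∷ g) (suc i) = coeff-+ₚ f g i

coeff-neg : ∀ f i → coeff (-ₚ f) i ≡ ℤ.- coeff f i
coeff-neg []      i       = refl
coeff-neg (a ∷ f) zero    = refl
coeff-neg (a ∷ f) (suc i) = coeff-neg f i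

coeff--ₚ : ∀ f g i → coeff (f -ₚ g) i ≡ coeff f i ℤ.- coeff g i
coeff--ₚ f g i = trans (coeff-+ₚ f (-ₚ g) i) (cong₂ ℤ._+_ {coeff f i} refl (coeff-neg g i))

≈-isEquivalence : IsEquivalence _≈_
≈-isEquivalence = record
  { refl  = λ _ → refl
  ; sym   = λ f≈g i → sym (f≈g i)
  ; trans = λ f≈g g≈h i → trans (f≈g i) (g≈h i)
  }

+ₚ-cong : ∀ {f f′ g g′} → f ≈ f′ → g ≈ g′ → f +ₚ g ≈ f′ +ₚ g′
+ₚ-cong {f} {f′} {g} {g′} f≈f′ g≈g′ i
  rewrite coeff-+ₚ f g i | coeff-+ₚ f′ g′ i = cong₂ ℤ._+_ (f≈f′ i) (g≈g′ i)

-ₚ-cong : ∀ {f f′ g g′} → f ≈ f′ → g ≈ g′ → f -ₚ g ≈ f′ -ₚ g′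
-ₚ-cong {f} {f′} {g} {g′} f≈f′ g≈g′ i
  rewrite coeff--ₚ f g i | coeff--ₚ f′ g′ i = cong₂ ℤ._-_ (f≈f′ i) (g≈g′ i)

∷-cong : ∀ {a b f g} → a ≡ b → f ≈ g → a ∷ f ≈ b ∷ g
∷-cong a≡b f≈g zero    = a≡b
∷-cong a≡b f≈g (suc i) = f≈g i

+ₚ-identityʳ : ∀ f → f +ₚ 0ₚ ≡ f
+ₚ-identityʳ []      = refl
+ₚ-identityʳ (a ∷ f) = refl

+ₚ-assoc : ∀ f g h → (f +ₚ g) +ₚ h ≈ f +ₚ (g +ₚ h)
+ₚ-assoc f g h i
  rewrite coeff-+ₚ (f +ₚ g) h i | coeff-+ₚ f g i | coeff-+ₚ f (g +ₚ h) i | coeff-+ₚ g h i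
  = ℤₚ.+-assoc (coeff f i) (coeff g i) (coeff h i)

-ₚ-inverseʳ : ∀ f → f -ₚ f ≈ 0ₚ
-ₚ-inverseʳ f i = trans (coeff--ₚ f f i) (ℤₚ.+-inverseʳ (coeff f i))

neg-minus : ∀ f g → -ₚ (f -ₚ g) ≈ g -ₚ f
neg-minus f g i
  rewrite coeff-neg (f -ₚ g) i | coeff--ₚ f g i | coeff--ₚ g f i
  = identity (coeff f i) (coeff g i)
  where
  identity : ∀ a b → ℤ.- (a ℤ.- b) ≡ b ℤ.- a
  identity = solve-∀

neg-minus-neg : ∀ f g → (-ₚ f) -ₚ (-ₚ g) ≈ g -ₚ f
neg-minus-neg f g i
  rewrite coeff--ₚ (-ₚ f) (-ₚ g) i | coeff-neg f i | coeff-neg g i | coeff--ₚ g f i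
  = identity (coeff f i) (coeff g i)
  where
  identity : ∀ a b → ℤ.- a ℤ.- ℤ.- b ≡ b ℤ.- a
  identity = solve-∀

minus-telescope : ∀ f g h → (h -ₚ g) +ₚ (g -ₚ f) ≈ h -ₚ f
minus-telescope f g h i
  rewrite coeff-+ₚ (h -ₚ g) (g -ₚ f) i | coeff--ₚ h g i | coeff--ₚ g f i | coeff--ₚ h f i
  = identity (coeff f i) (coeff g i) (coeff h i)
  where
  identity : ∀ a b c → (c ℤ.- b) ℤ.+ (b ℤ.- a) ≡ c ℤ.- a
  identity = solve-∀

minus≈0⇒≈ : ∀ {f g} → g -ₚ f ≈ 0ₚ → f ≈ g
minus≈0⇒≈ {f} {g} g-f≈0 i =
  sym (ℤₚ.i-j≡0⇒i≡j (coeff g i) (coeff f i) (trans (sym (coeff--ₚ g f i)) (g-f≈0 i)))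

add-one-minus : ∀ f → (f +ₚ 1ₚ) -ₚ f ≈ 1ₚ
add-one-minus f i
  rewrite coeff--ₚ (f +ₚ 1ₚ) f i | coeff-+ₚ f 1ₚ i = identity (coeff f i) (coeff 1ₚ i)
  where
  identity : ∀ a b → (a ℤ.+ b) ℤ.- a ≡ b
  identity = solve-∀

minus-minus-one : ∀ f → f -ₚ (f -ₚ 1ₚ) ≈ 1ₚ
minus-minus-one f i
  rewrite coeff--ₚ f (f -ₚ 1ₚ) i | coeff--ₚ f 1ₚ i = identity (coeff f i) (coeff 1ₚ i)
  where
  identity : ∀ a b → a ℤ.- (a ℤ.- b) ≡ b
  identity = solve-∀

shift-+ₚ : ∀ n f g → shift n (f +ₚ g) ≡ shift n f +ₚ shift n g
shift-+ₚ zero    f g = refl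
shift-+ₚ (suc n) f g = cong (0ℤ ∷_) (shift-+ₚ n f g)

shift-neg : ∀ n f → shift n (-ₚ f) ≡ -ₚ shift n f
shift-neg zero    f = refl
shift-neg (suc n) f = cong (0ℤ ∷_) (shift-neg n f)

shift--ₚ : ∀ n f g → shift n (f -ₚ g) ≡ shift n f -ₚ shift n g
shift--ₚ n f g = trans (shift-+ₚ n f (-ₚ g)) (cong (shift n f +ₚ_) (shift-neg n g))

shift-0∷ : ∀ n f → shift n (0ℤ ∷ f) ≡ shift (suc n) f
shift-0∷ zero    f = refl
shift-0∷ (suc n) f = cong (0ℤ ∷_) (shift-0∷ n f)

shift-≈0 : ∀ n {f} → f ≈ 0ₚ → shift n f ≈ 0ₚ
shift-≈0 zero    f≈0         = f≈0
shift-≈0 (suc n) f≈0 zero    = refl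
shift-≈0 (suc n) f≈0 (suc i) = shift-≈0 n f≈0 i

-- Signs

NonNegative : ℤ[x] → Set
NonNegative f = f ≈ 0ₚ ⊎ Positive f

Positive-resp-≈ : ∀ {f g} → f ≈ g → Positive f → Positive g
Positive-resp-≈ f≈g (mkPositive d l a) =
  mkPositive d (subst (0ℤ ℤ.<_) (f≈g d) l) λ i d<i → trans (sym (f≈g i)) (a i d<i)

NonNegative-resp-≈ : ∀ {f g} → f ≈ g → NonNegative f → NonNegative g
NonNegative-resp-≈ f≈g (inj₁ f≈0) = inj₁ λ i → trans (sym (f≈g i)) (f≈0 i)
NonNegative-resp-≈ f≈g (inj₂ f>0) = inj₂ (Positive-resp-≈ f≈g f>0)

Positive⇒≉0 : ∀ {f} → Positive f → ¬ f ≈ 0ₚ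
Positive⇒≉0 (mkPositive d l _) f≈0 = ℤₚ.<-irrefl refl (subst (0ℤ ℤ.<_) (f≈0 d) l)

-- The summand of larger degree supplies the leading coefficient; at equal degrees two positive
-- leading coefficients add up, so nothing cancels.
positive+positive : ∀ {f g} → Positive f → Positive g → Positive (f +ₚ g)
positive+positive {f} {g} (mkPositive m f>0 f≡0) (mkPositive n g>0 g≡0) with ℕₚ.<-cmp m n
... | tri< m<n _ _ = mkPositive n
  (subst (0ℤ ℤ.<_) (sym (trans (coeff-+ₚ f g n) (cong₂ ℤ._+_ (f≡0 n m<n) refl)))
    (subst (0ℤ ℤ.<_) (sym (ℤₚ.+-identityˡ _)) g>0))
  λ i n<i → trans (coeff-+ₚ f g i) (cong₂ ℤ._+_ (f≡0 i (ℕₚ.<-trans m<n n<i)) (g≡0 i n<i))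
... | tri≈ _ refl _ = mkPositive n
  (subst (0ℤ ℤ.<_) (sym (coeff-+ₚ f g n)) (ℤₚ.+-mono-< f>0 g>0))
  λ i n<i → trans (coeff-+ₚ f g i) (cong₂ ℤ._+_ (f≡0 i n<i) (g≡0 i n<i))
... | tri> _ _ n<m = mkPositive m
  (subst (0ℤ ℤ.<_) (sym (trans (coeff-+ₚ f g m) (cong₂ ℤ._+_ {coeff f m} refl (g≡0 m n<m))))
    (subst (0ℤ ℤ.<_) (sym (ℤₚ.+-identityʳ _)) f>0))
  λ i m<i → trans (coeff-+ₚ f g i) (cong₂ ℤ._+_ (f≡0 i m<i) (g≡0 i (ℕₚ.<-trans n<m m<i)))

positive+nonNegative : ∀ {f g} → Positive f → NonNegative g → Positive (f +ₚ g)
positive+nonNegative {f} {g} f>0 (inj₁ g≈0) =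
  Positive-resp-≈
    (λ i → trans (cong (λ h → coeff h i) (sym (+ₚ-identityʳ f)))
                 (+ₚ-cong {f} {f} {0ₚ} {g} (λ _ → refl) (λ i → sym (g≈0 i)) i))
    f>0
positive+nonNegative f>0 (inj₂ g>0) = positive+positive f>0 g>0

nonNegative+positive : ∀ {f g} → NonNegative f → Positive g → Positive (f +ₚ g)
nonNegative+positive {f} {g} (inj₁ f≈0) g>0 =
  Positive-resp-≈ (+ₚ-cong {0ₚ} {f} {g} {g} (λ i → sym (f≈0 i)) (λ _ → refl)) g>0
nonNegative+positive (inj₂ f>0) g>0 = positive+positive f>0 g>0

nonNegative+nonNegative : ∀ {f g} → NonNegative f → NonNegative g → NonNegative (f +ₚ g)
nonNegative+nonNegative {f} {g} (inj₁ f≈0) (inj₁ g≈0) = inj₁ (+ₚ-cong {f} {0ₚ} {g} {0ₚ} f≈0 g≈0)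
nonNegative+nonNegative f≥0 (inj₂ g>0) = inj₂ (nonNegative+positive f≥0 g>0)
nonNegative+nonNegative (inj₂ f>0) g≥0 = inj₂ (positive+nonNegative f>0 g≥0)

-- Otherwise `f -ₚ f` would be positive. This is the contradiction behind every impossible
-- comparison below.
positive⇒¬nonNegative-neg : ∀ {f} → Positive f → ¬ NonNegative (-ₚ f)
positive⇒¬nonNegative-neg {f} f>0 -f≥0 =
  Positive⇒≉0 (positive+nonNegative f>0 -f≥0) (-ₚ-inverseʳ f)

∷-positive : ∀ {a f} → Positive f → Positive (a ∷ f)
∷-positive (mkPositive d l a) = mkPositive (suc d) l λ { (suc i) (s≤s d<i) → a i d<i }

∷-positive₀ : ∀ {a f} → f ≈ 0ₚ → 0ℤ ℤ.< a → Positive (a ∷ f)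
∷-positive₀ f≈0 0<a = mkPositive 0 0<a λ { (suc i) _ → f≈0 i }

∷-nonNegative₀ : ∀ {a f} → f ≈ 0ₚ → 0ℤ ℤ.≤ a → NonNegative (a ∷ f)
∷-nonNegative₀ {+ zero}    f≈0 _ = inj₁ λ { zero → refl ; (suc i) → f≈0 i }
∷-nonNegative₀ {+ (suc _)} f≈0 _ = inj₂ (∷-positive₀ f≈0 (ℤ.+<+ (s≤s z≤n)))

-- The alternatives are degree at least 1, where the tail alone carries the sign, and degree 0,
-- where the sign is that of the constant term.
positive-∷⁻ : ∀ {a f} → Positive (a ∷ f) → Positive f ⊎ (f ≈ 0ₚ × 0ℤ ℤ.< a)
positive-∷⁻ (mkPositive zero    l a) = inj₂ ((λ i → a (suc i) (s≤s z≤n)) , l)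
positive-∷⁻ (mkPositive (suc d) l a) = inj₁ (mkPositive d l λ i d<i → a (suc i) (s≤s d<i))

nonNegative-∷⁻ : ∀ {a f} → NonNegative (a ∷ f) → Positive f ⊎ (f ≈ 0ₚ × 0ℤ ℤ.≤ a)
nonNegative-∷⁻ (inj₁ a∷f≈0) = inj₂ ((λ i → a∷f≈0 (suc i)) , ℤₚ.≤-reflexive (sym (a∷f≈0 0)))
nonNegative-∷⁻ (inj₂ a∷f>0) with positive-∷⁻ a∷f>0
... | inj₁ f>0         = inj₁ f>0
... | inj₂ (f≈0 , 0<a) = inj₂ (f≈0 , ℤₚ.<⇒≤ 0<a)

nonNegative-tail : ∀ {a f} → NonNegative (a ∷ f) → NonNegative f
nonNegative-tail a∷f≥0 with nonNegative-∷⁻ a∷f≥0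
... | inj₁ f>0       = inj₂ f>0
... | inj₂ (f≈0 , _) = inj₁ f≈0

-- Induction towards the leading coefficient: a nonzero tail decides the sign, and the constant term
-- is consulted only when the tail vanishes.
sign : ∀ f → Positive (-ₚ f) ⊎ NonNegative f
sign []      = inj₂ (inj₁ (λ _ → refl))
sign (a ∷ f) with sign f
... | inj₁ -f>0       = inj₁ (∷-positive -f>0)
... | inj₂ (inj₂ f>0) = inj₂ (inj₂ (∷-positive f>0))
sign (+ n ∷ f)      | inj₂ (inj₁ f≈0) = inj₂ (∷-nonNegative₀ f≈0 (ℤ.+≤+ z≤n))
sign (-[1+ n ] ∷ f) | inj₂ (inj₁ f≈0) =
  inj₁ (∷-positive₀ (λ i → trans (coeff-neg f i) (cong ℤ.-_ (f≈0 i))) (ℤ.+<+ (s≤s z≤n)))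

-- Discreteness of the order. In degree at least 1 subtracting 1 leaves the leading coefficient
-- alone; in degree 0 it is discreteness of the integers.
positive⇒nonNegative-pred : ∀ {f} → Positive f → NonNegative (f -ₚ 1ₚ)
positive⇒nonNegative-pred {[]}    f>0 = contradiction (λ _ → refl) (Positive⇒≉0 f>0)
positive⇒nonNegative-pred {a ∷ f} f>0 rewrite +ₚ-identityʳ f with positive-∷⁻ f>0
... | inj₁ f′>0        = inj₂ (∷-positive f′>0)
... | inj₂ (f≈0 , 0<a) = ∷-nonNegative₀ f≈0 (ℤₚ.i≤j⇒0≤j-i (ℤₚ.i<j⇒suc[i]≤j 0<a))

shift-nonNegative : ∀ n {f} → NonNegative f → NonNegative (shift n f)
shift-nonNegative n       (inj₁ f≈0) = inj₁ (shift-≈0 n f≈0)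
shift-nonNegative zero    (inj₂ f>0) = inj₂ f>0
shift-nonNegative (suc n) (inj₂ f>0) with shift-nonNegative n (inj₂ f>0)
... | inj₁ s≈0 = inj₁ λ { zero → refl ; (suc i) → s≈0 i }
... | inj₂ s>0 = inj₂ (∷-positive s>0)

-- The order by the sign of the difference

_<ₚ_ : Rel ℤ[x] 0ℓ
f <ₚ g = Positive (g -ₚ f)

<ₚ-respˡ-≈ : ∀ {f g h} → f ≈ g → f <ₚ h → g <ₚ h
<ₚ-respˡ-≈ {f} {g} {h} f≈g = Positive-resp-≈ (-ₚ-cong {h} {h} {f} {g} (λ _ → refl) f≈g)

<ₚ-respʳ-≈ : ∀ {f g h} → g ≈ h → f <ₚ g → f <ₚ h
<ₚ-respʳ-≈ {f} {g} {h} g≈h = Positive-resp-≈ (-ₚ-cong {g} {h} {f} {f} g≈h (λ _ → refl))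

<ₚ-irrefl : ∀ {f g} → f ≈ g → ¬ f <ₚ g
<ₚ-irrefl {f} {g} f≈g f<g = Positive⇒≉0 (<ₚ-respˡ-≈ {f} {g} {g} f≈g f<g) (-ₚ-inverseʳ g)

<ₚ-trans : Transitive _<ₚ_
<ₚ-trans {f} {g} {h} f<g g<h = Positive-resp-≈ (minus-telescope f g h) (positive+positive g<h f<g)

<ₚ-asym : ∀ {f g} → f <ₚ g → ¬ g <ₚ f
<ₚ-asym {f} {g} f<g g<f = <ₚ-irrefl {f} {f} (λ _ → refl) (<ₚ-trans {f} {g} {f} f<g g<f)

<ₚ-cmp : Trichotomous _≈_ _<ₚ_
<ₚ-cmp f g with sign (g -ₚ f)
... | inj₁ f-g>0 = tri> (<ₚ-asym {g} {f} g<f) (λ f≈g → <ₚ-irrefl {g} {f} (λ i → sym (f≈g i)) g<f) g<f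
  where
  g<f : g <ₚ f
  g<f = Positive-resp-≈ (neg-minus g f) f-g>0
... | inj₂ (inj₁ g-f≈0) = tri≈ (<ₚ-irrefl {f} {g} f≈g) f≈g (<ₚ-irrefl {g} {f} (λ i → sym (f≈g i)))
  where
  f≈g : f ≈ g
  f≈g = minus≈0⇒≈ {f} {g} g-f≈0
... | inj₂ (inj₂ f<g) = tri< f<g (λ f≈g → <ₚ-irrefl {f} {g} f≈g f<g) (<ₚ-asym {f} {g} f<g)

<ₚ-isStrictTotalOrder : IsStrictTotalOrder _≈_ _<ₚ_
<ₚ-isStrictTotalOrder = isStrictTotalOrderᶜ record
  { isEquivalence = ≈-isEquivalence
  ; trans         = λ {f} {g} {h} → <ₚ-trans {f} {g} {h}
  ; compare       = <ₚ-cmp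
  }

-- Digit strings

-- Two digits of the same kind differ by a positive constant; in the mixed case the difference is
-- monic of degree 1, whatever its constant term.
<ᴰ⇒<ₚ : ∀ {b c} → b <ᴰ c → ⟦ b ⟧ <ₚ ⟦ c ⟧
<ᴰ⇒<ₚ (const<const m<n) = ∷-positive₀ (λ _ → refl) (i<j⇒0<j-i (ℤ.+<+ m<n))
<ᴰ⇒<ₚ const<x-          = ∷-positive (∷-positive₀ (λ _ → refl) (ℤ.+<+ (s≤s z≤n)))
<ᴰ⇒<ₚ (x-<x- n<m)       =
  ∷-positive₀ (λ { zero → refl ; (suc _) → refl }) (i<j⇒0<j-i (ℤ.-<- n<m))

digit-nonNegative : ∀ b → NonNegative ⟦ b ⟧
digit-nonNegative (const n)  = ∷-nonNegative₀ (λ _ → refl) (ℤ.+≤+ z≤n)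
digit-nonNegative x-[1+ n ]  = inj₂ (∷-positive (∷-positive₀ (λ _ → refl) (ℤ.+<+ (s≤s z≤n))))

digit<x : ∀ b → ⟦ b ⟧ <ₚ shift 1 1ₚ
digit<x (const n) = ∷-positive (∷-positive₀ (λ _ → refl) (ℤ.+<+ (s≤s z≤n)))
digit<x x-[1+ n ] = ∷-positive₀ (λ { zero → refl ; (suc _) → refl }) (ℤ.+<+ (s≤s z≤n))

const0<digit : ∀ {b} → b ≢ const 0 → const 0 <ᴰ b
const0<digit {const zero}    b≢0 = contradiction refl b≢0
const0<digit {const (suc n)} b≢0 = const<const (s≤s z≤n)
const0<digit {x-[1+ n ]}     b≢0 = const<x-

-- Discreteness gives B + 1 ≤ C, so that xᵏ C - xᵏ B absorbs the xᵏ above R.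
leading-dominates : ∀ k B C {R S} → B <ₚ C → R <ₚ shift k 1ₚ → NonNegative S →
                    shift k B +ₚ R <ₚ shift k C +ₚ S
leading-dominates k B C {R} {S} B<C R<xᵏ S≥0 =
  Positive-resp-≈ regroup
    (positive+nonNegative
      (nonNegative+positive (shift-nonNegative k (positive⇒nonNegative-pred B<C)) R<xᵏ) S≥0)
  where
  -- Here `u` is a coefficient of xᵏ: the xᵏ given up by `C -ₚ B` is the one that bounds `R`, so it
  -- cancels.
  identity : ∀ b c u r s → (((c ℤ.- b) ℤ.- u) ℤ.+ (u ℤ.- r)) ℤ.+ s ≡ (c ℤ.+ s) ℤ.- (b ℤ.+ r)
  identity = solve-∀

  regroup : (shift k ((C -ₚ B) -ₚ 1ₚ) +ₚ (shift k 1ₚ -ₚ R)) +ₚ S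
            ≈ (shift k C +ₚ S) -ₚ (shift k B +ₚ R)
  regroup i
    rewrite coeff-+ₚ (shift k ((C -ₚ B) -ₚ 1ₚ) +ₚ (shift k 1ₚ -ₚ R)) S i
          | coeff-+ₚ (shift k ((C -ₚ B) -ₚ 1ₚ)) (shift k 1ₚ -ₚ R) i
          | shift--ₚ k (C -ₚ B) 1ₚ
          | coeff--ₚ (shift k (C -ₚ B)) (shift k 1ₚ) i
          | shift--ₚ k C B
          | coeff--ₚ (shift k C) (shift k B) i
          | coeff--ₚ (shift k 1ₚ) R i
          | coeff--ₚ (shift k C +ₚ S) (shift k B +ₚ R) i
          | coeff-+ₚ (shift k C) S i
          | coeff-+ₚ (shift k B) R i
    = identity (coeff (shift k B) i) (coeff (shift k C) i) (coeff (shift k 1ₚ) i) (coeff R i) (coeff S i)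

[]ₓ-nonNegative : ∀ bs → NonNegative [ bs ]ₓ
[]ₓ-nonNegative []       = inj₁ (λ _ → refl)
[]ₓ-nonNegative (b ∷ bs) =
  nonNegative+nonNegative (shift-nonNegative (length bs) (digit-nonNegative b)) ([]ₓ-nonNegative bs)

-- Dominance applied to the leading parts ⟦ b ⟧ and x, with remainder 0 on the right, since xᵏ times
-- x is the next power.
digit-shift<x^ : ∀ b k {R} → R <ₚ shift k 1ₚ → shift k ⟦ b ⟧ +ₚ R <ₚ shift (suc k) 1ₚ
digit-shift<x^ b k {R} R<xᵏ =
  subst (shift k ⟦ b ⟧ +ₚ R <ₚ_) (trans (+ₚ-identityʳ _) (shift-0∷ k 1ₚ))
    (leading-dominates k ⟦ b ⟧ (shift 1 1ₚ) {R} {0ₚ} (digit<x b) R<xᵏ (inj₁ (λ _ → refl)))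

[]ₓ<x^length : ∀ bs → [ bs ]ₓ <ₚ shift (length bs) 1ₚ
[]ₓ<x^length []       = ∷-positive₀ (λ _ → refl) (ℤ.+<+ (s≤s z≤n))
[]ₓ<x^length (b ∷ bs) = digit-shift<x^ b (length bs) {[ bs ]ₓ} ([]ₓ<x^length bs)

shift-const0-+ₚ : ∀ k R → shift k ⟦ const 0 ⟧ +ₚ R ≈ R
shift-const0-+ₚ k R =
  +ₚ-cong {shift k ⟦ const 0 ⟧} {0ₚ} {R} {R}
    (shift-≈0 k λ { zero → refl ; (suc _) → refl }) (λ _ → refl)

-- Each step up in the exponent prepends a digit 0 to `R`, which keeps its value while the bound
-- grows by a factor x.
<x^-mono : ∀ {R m n} → m ℕ.≤′ n → R <ₚ shift m 1ₚ → R <ₚ shift n 1ₚ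
<x^-mono     ℕ.≤′-refl               R<xᵐ = R<xᵐ
<x^-mono {R} {m} (ℕ.≤′-step {n} m≤n) R<xᵐ =
  <ₚ-respˡ-≈ {shift n ⟦ const 0 ⟧ +ₚ R} {R} {shift (suc n) 1ₚ} (shift-const0-+ₚ n R)
    (digit-shift<x^ (const 0) n {R} (<x^-mono {R} m≤n R<xᵐ))

-- Give the shorter string a digit 0 in the position of `c`. As `c` is nonzero, the comparison is
-- already decided there.
shorter⇒<ₚ : ∀ {bs c cs} → c ≢ const 0 → length bs ℕ.≤ length cs → [ bs ]ₓ <ₚ [ c ∷ cs ]ₓ
shorter⇒<ₚ {bs} {c} {cs} c≢0 bs≤cs =
  <ₚ-respˡ-≈ {shift k ⟦ const 0 ⟧ +ₚ [ bs ]ₓ} {[ bs ]ₓ} {[ c ∷ cs ]ₓ} (shift-const0-+ₚ k [ bs ]ₓ)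
    (leading-dominates k ⟦ const 0 ⟧ ⟦ c ⟧ {[ bs ]ₓ} {[ cs ]ₓ} (<ᴰ⇒<ₚ (const0<digit c≢0))
      (<x^-mono {[ bs ]ₓ} (ℕₚ.≤⇒≤′ bs≤cs) ([]ₓ<x^length bs)) ([]ₓ-nonNegative cs))
  where k = length cs

-- Equal lengths put corresponding digits at the same power of x. Common leading digits cancel in
-- the difference, and the first distinct pair dominates all that follows.
lex⇒<ₚ : ∀ {bs cs} → length bs ≡ length cs → Lex-< _≡_ _<ᴰ_ bs cs → [ bs ]ₓ <ₚ [ cs ]ₓ
lex⇒<ₚ {b ∷ bs} {c ∷ cs} eq (this b<c)
  rewrite sym (ℕₚ.suc-injective eq) =
  leading-dominates (length bs) ⟦ b ⟧ ⟦ c ⟧ {[ bs ]ₓ} {[ cs ]ₓ}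
    (<ᴰ⇒<ₚ b<c) ([]ₓ<x^length bs) ([]ₓ-nonNegative cs)
lex⇒<ₚ {b ∷ bs} {b ∷ cs} eq (next refl bs<cs)
  rewrite sym (ℕₚ.suc-injective eq) =
  Positive-resp-≈ cancel (lex⇒<ₚ {bs} {cs} (ℕₚ.suc-injective eq) bs<cs)
  where
  P = shift (length bs) ⟦ b ⟧

  identity : ∀ p b c → c ℤ.- b ≡ (p ℤ.+ c) ℤ.- (p ℤ.+ b)
  identity = solve-∀

  cancel : [ cs ]ₓ -ₚ [ bs ]ₓ ≈ (P +ₚ [ cs ]ₓ) -ₚ (P +ₚ [ bs ]ₓ)
  cancel i
    rewrite coeff--ₚ [ cs ]ₓ [ bs ]ₓ i | coeff--ₚ (P +ₚ [ cs ]ₓ) (P +ₚ [ bs ]ₓ) i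
          | coeff-+ₚ P [ cs ]ₓ i | coeff-+ₚ P [ bs ]ₓ i
    = identity (coeff P i) (coeff [ bs ]ₓ i) (coeff [ cs ]ₓ i)

≺⇒<ₚ : ∀ {bs cs} → IsNumeral bs → IsNumeral cs → bs ≺ cs → [ bs ]ₓ <ₚ [ cs ]ₓ
≺⇒<ₚ {b ∷ bs} {c ∷ cs} _ (nonzeroLeading c≢0) (inj₁ (s≤s bs≤cs)) =
  shorter⇒<ₚ {b ∷ bs} {c} {cs} c≢0 bs≤cs
-- Only the empty string is shorter than the numeral of 0, and it is not a numeral.
≺⇒<ₚ (nonzeroLeading _) zeroNumeral          (inj₁ (s≤s ()))
≺⇒<ₚ zeroNumeral        zeroNumeral          (inj₁ (s≤s ()))
≺⇒<ₚ _                  _                    (inj₂ (eq , bs<cs)) = lex⇒<ₚ eq bs<cs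

-- Existence of numerals

singleton-numeral : ∀ d → IsNumeral (d ∷ [])
singleton-numeral (const zero)    = zeroNumeral
singleton-numeral (const (suc n)) = nonzeroLeading λ ()
singleton-numeral x-[1+ n ]       = nonzeroLeading λ ()

-- Horner's rule. Evaluation recurses on the leading digit, whereas numerals are built from the
-- constant term, so this links the two directions.
[]ₓ-∷ʳ : ∀ bs d → [ bs ++ d ∷ [] ]ₓ ≈ (0ℤ ∷ [ bs ]ₓ) +ₚ ⟦ d ⟧
[]ₓ-∷ʳ []       (const n)  = λ { zero → sym (ℤₚ.+-identityˡ _) ; (suc _) → refl }
[]ₓ-∷ʳ []       x-[1+ n ]  = λ { zero → refl ; (suc _) → refl }
[]ₓ-∷ʳ (b ∷ bs) d
  -- With the length in the form `suc (length bs)`, the shifted leading digit becomes `0ℤ ∷ P`.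
  rewrite trans (length-++ bs {d ∷ []}) (ℕₚ.+-comm (length bs) 1) =
  λ i → trans
    (+ₚ-cong {0ℤ ∷ P} {0ℤ ∷ P} {[ bs ++ d ∷ [] ]ₓ} {(0ℤ ∷ [ bs ]ₓ) +ₚ ⟦ d ⟧}
      (λ _ → refl) ([]ₓ-∷ʳ bs d) i)
    (sym (+ₚ-assoc (0ℤ ∷ P) (0ℤ ∷ [ bs ]ₓ) ⟦ d ⟧ i))
  where P = shift (length bs) ⟦ b ⟧

-- The numeral of 0 is treated apart: appending to it would leave a leading zero, so `d` alone is
-- taken instead.
append-digit : ∀ {f} d → ∃ (_Represents f) → ∃ (_Represents ((0ℤ ∷ f) +ₚ ⟦ d ⟧))
append-digit {f} d (_ , zeroNumeral , 0≈f) =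
  d ∷ [] , singleton-numeral d ,
  λ i → trans ([]ₓ-∷ʳ [] d i)
    (+ₚ-cong {0ℤ ∷ []} {0ℤ ∷ f} {⟦ d ⟧} {⟦ d ⟧} (∷-cong {f = []} {f} refl 0≈f′) (λ _ → refl) i)
  where
  0≈f′ : [] ≈ f
  0≈f′ zero    = 0≈f zero
  0≈f′ (suc i) = 0≈f (suc i)
append-digit {f} d (b ∷ bs , nonzeroLeading b≢0 , bs≈f) =
  b ∷ bs ++ d ∷ [] , nonzeroLeading b≢0 ,
  λ i → trans ([]ₓ-∷ʳ (b ∷ bs) d i)
    (+ₚ-cong {0ℤ ∷ [ b ∷ bs ]ₓ} {0ℤ ∷ f} {⟦ d ⟧} {⟦ d ⟧}
      (∷-cong {f = [ b ∷ bs ]ₓ} {f} refl bs≈f) (λ _ → refl) i)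

Represents-resp-≈ : ∀ {f g} → f ≈ g → ∃ (_Represents f) → ∃ (_Represents g)
Represents-resp-≈ f≈g (bs , num , bs≈f) = bs , num , λ i → trans (bs≈f i) (f≈g i)

-- The constant term yields the last digit and the remaining coefficients yield the others. Head and
-- tail are separate arguments so that the recursion stays structural in `f` when borrowing changes
-- the head.
numeral-∷ : ∀ a f → NonNegative (a ∷ f) → ∃ (_Represents (a ∷ f))
numeral-∷ (+ n)    []      _   = const n ∷ [] , singleton-numeral (const n) , (λ _ → refl)
numeral-∷ -[1+ n ] []      a≥0 with nonNegative-∷⁻ a≥0
... | inj₁ 0>0      = contradiction (λ _ → refl) (Positive⇒≉0 0>0)
... | inj₂ (_ , ())
numeral-∷ (+ n)    (b ∷ f) g≥0 =
  append-digit {b ∷ f} (const n) (numeral-∷ b f (nonNegative-tail g≥0))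
numeral-∷ -[1+ n ] (b ∷ f) g≥0 with nonNegative-∷⁻ g≥0
... | inj₂ (_ , ())
-- Below a negative constant term the tail is positive, hence can lend 1 and stay nonnegative.
... | inj₁ b∷f>0 =
  Represents-resp-≈ {(0ℤ ∷ (b ℤ.- 1ℤ) ∷ f) +ₚ ⟦ x-[1+ n ] ⟧} { -[1+ n ] ∷ b ∷ f} carry
    (append-digit {(b ℤ.- 1ℤ) ∷ f} x-[1+ n ] (numeral-∷ (b ℤ.- 1ℤ) f b-1∷f≥0))
  where
  b-1∷f≥0 : NonNegative ((b ℤ.- 1ℤ) ∷ f)
  b-1∷f≥0 = subst (λ g → NonNegative ((b ℤ.- 1ℤ) ∷ g)) (+ₚ-identityʳ f)
              (positive⇒nonNegative-pred b∷f>0)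

  identity : ∀ b u → (b ℤ.- u) ℤ.+ u ≡ b
  identity = solve-∀

  carry : (0ℤ ∷ (b ℤ.- 1ℤ) ∷ f) +ₚ ⟦ x-[1+ n ] ⟧ ≈ -[1+ n ] ∷ b ∷ f
  carry = λ { zero          → refl
            ; (suc zero)    → identity b 1ℤ
            ; (suc (suc i)) → cong (λ g → coeff g i) (+ₚ-identityʳ f) }

numeral : ∀ {f} → Positive f → ∃ (_Represents f)
numeral {[]}    f>0 = contradiction (λ _ → refl) (Positive⇒≉0 f>0)
numeral {a ∷ f} f>0 = numeral-∷ a f (inj₂ f>0)

-- Agreement of the orders

<ᴰ-trans : Transitive _<ᴰ_
<ᴰ-trans (const<const l<m) (const<const m<n) = const<const (ℕₚ.<-trans l<m m<n)
<ᴰ-trans (const<const _)   const<x-          = const<x-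
<ᴰ-trans const<x-          (x-<x- _)         = const<x-
<ᴰ-trans (x-<x- m<l)       (x-<x- n<m)       = x-<x- (ℕₚ.<-trans n<m m<l)

<ᴰ-cmp : Trichotomous _≡_ _<ᴰ_
<ᴰ-cmp (const m)  x-[1+ n ] = tri< const<x- (λ ()) (λ ())
<ᴰ-cmp x-[1+ m ]  (const n) = tri> (λ ()) (λ ()) const<x-
<ᴰ-cmp (const m)  (const n) with ℕₚ.<-cmp m n
... | tri< m<n m≢n n≮m =
  tri< (const<const m<n) (λ { refl → m≢n refl }) (λ { (const<const n<m) → n≮m n<m })
... | tri≈ m≮n refl n≮m =
  tri≈ (λ { (const<const m<n) → m≮n m<n }) refl (λ { (const<const n<m) → n≮m n<m })
... | tri> m≮n m≢n n<m =
  tri> (λ { (const<const m<n) → m≮n m<n }) (λ { refl → m≢n refl }) (const<const n<m)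
<ᴰ-cmp x-[1+ m ]  x-[1+ n ] with ℕₚ.<-cmp m n
... | tri< m<n m≢n n≮m =
  tri> (λ { (x-<x- n<m) → n≮m n<m }) (λ { refl → m≢n refl }) (x-<x- m<n)
... | tri≈ m≮n refl n≮m =
  tri≈ (λ { (x-<x- n<m) → n≮m n<m }) refl (λ { (x-<x- m<n) → m≮n m<n })
... | tri> m≮n m≢n n<m =
  tri< (x-<x- n<m) (λ { refl → m≢n refl }) (λ { (x-<x- m<n) → m≮n m<n })

<ᴰ-isStrictTotalOrder : IsStrictTotalOrder _≡_ _<ᴰ_
<ᴰ-isStrictTotalOrder = isStrictTotalOrderᶜ record
  { isEquivalence = isEquivalence
  ; trans         = <ᴰ-trans
  ; compare       = <ᴰ-cmp
  }

≺-connex : ∀ bs cs → bs ≺ cs ⊎ bs ≡ cs ⊎ cs ≺ bs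
≺-connex bs cs with ℕₚ.<-cmp (length bs) (length cs)
... | tri< lt _ _ = inj₁ (inj₁ lt)
... | tri> _ _ gt = inj₂ (inj₂ (inj₁ gt))
... | tri≈ _ eq _ with Lex.<-compare sym <ᴰ-cmp bs cs
...   | tri< lt _ _   = inj₁ (inj₂ (eq , lt))
...   | tri≈ _ bs≋cs _ = inj₂ (inj₁ (Pointwise-≡⇒≡ bs≋cs))
...   | tri> _ _ gt   = inj₂ (inj₂ (inj₂ (sym eq , gt)))

-- A strictly monotone map out of a connex relation reflects the order: the other two alternatives
-- contradict irreflexivity and asymmetry of `<ₚ`.
<ₚ⇒≺ : ∀ {bs cs} → IsNumeral bs → IsNumeral cs → [ bs ]ₓ <ₚ [ cs ]ₓ → bs ≺ cs
<ₚ⇒≺ {bs} {cs} nbs ncs lt with ≺-connex bs cs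
... | inj₁ bs≺cs        = bs≺cs
... | inj₂ (inj₁ refl)  = contradiction lt (<ₚ-irrefl {[ bs ]ₓ} {[ bs ]ₓ} (λ _ → refl))
... | inj₂ (inj₂ cs≺bs) = contradiction (≺⇒<ₚ ncs nbs cs≺bs) (<ₚ-asym {[ bs ]ₓ} {[ cs ]ₓ} lt)

<ᴰ⇔<ₚ : ∀ a b → a <ᴰ b ⇔ ⟦ a ⟧ <ₚ ⟦ b ⟧
<ᴰ⇔<ₚ a b = mk⇔ <ᴰ⇒<ₚ reflect
  where
  reflect : ⟦ a ⟧ <ₚ ⟦ b ⟧ → a <ᴰ b
  reflect lt with <ᴰ-cmp a b
  ... | tri< a<b _ _  = a<b
  ... | tri≈ _ refl _ = contradiction lt (<ₚ-irrefl {⟦ a ⟧} {⟦ a ⟧} (λ _ → refl))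
  ... | tri> _ _ b<a  = contradiction (<ᴰ⇒<ₚ b<a) (<ₚ-asym {⟦ a ⟧} {⟦ b ⟧} lt)

-- Numerals enter only through their values, so any representing pair gives the same comparison;
-- conversely `numeral` supplies the witnesses.
<⁺⇔<ₚ : ∀ f g → f <⁺ g ⇔ proj₁ f <ₚ proj₁ g
<⁺⇔<ₚ (f , f>0) (g , g>0) = mk⇔
  (λ (bs , cs , (nbs , bs≈f) , (ncs , cs≈g) , bs≺cs) →
    <ₚ-respˡ-≈ {[ bs ]ₓ} {f} {g} bs≈f
      (<ₚ-respʳ-≈ {[ bs ]ₓ} {[ cs ]ₓ} {g} cs≈g (≺⇒<ₚ nbs ncs bs≺cs)))
  λ f<g →
    let bs , nbs , bs≈f = numeral f>0
        cs , ncs , cs≈g = numeral g>0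
    in bs , cs , (nbs , bs≈f) , (ncs , cs≈g) ,
       <ₚ⇒≺ nbs ncs
         (<ₚ-respˡ-≈ {f} {[ bs ]ₓ} {[ cs ]ₓ} (λ i → sym (bs≈f i))
           (<ₚ-respʳ-≈ {f} {g} {[ cs ]ₓ} (λ i → sym (cs≈g i)) f<g))

-- Here `f -ₚ g` is a sum of nonnegative polynomials. This excludes the sign patterns that match no
-- constructor of `<`.
nonNegative≮nonPositive : ∀ {f g} → NonNegative f → NonNegative (-ₚ g) → ¬ f <ₚ g
nonNegative≮nonPositive {f} {g} f≥0 -g≥0 f<g =
  positive⇒¬nonNegative-neg f<g
    (NonNegative-resp-≈ {f -ₚ g} {_} (λ i → sym (neg-minus g f i))
      (nonNegative+nonNegative {f} {_} f≥0 -g≥0))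

neg-≈0 : ∀ {f} → f ≈ 0ₚ → -ₚ f ≈ 0ₚ
neg-≈0 {f} f≈0 i = trans (coeff-neg f i) (cong ℤ.-_ (f≈0 i))

<⇒<ₚ : ∀ {f g} → f < g → f <ₚ g
<⇒<ₚ (pos<pos f>0 g>0 lt)      = Equivalence.to (<⁺⇔<ₚ (_ , f>0) (_ , g>0)) lt
<⇒<ₚ {f} (zero<pos f≈0 g>0)    = positive+nonNegative g>0 (inj₁ (neg-≈0 {f} f≈0))
<⇒<ₚ (neg<zero -f>0 g≈0)       = nonNegative+positive (inj₁ g≈0) -f>0
<⇒<ₚ (neg<pos -f>0 g>0)        = positive+positive g>0 -f>0
<⇒<ₚ {f} {g} (neg<neg -f>0 -g>0 lt) =
  Positive-resp-≈ (neg-minus-neg f g) (Equivalence.to (<⁺⇔<ₚ (_ , -g>0) (_ , -f>0)) lt)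

-- The signs of `f` and `g` select the constructor. For two negatives, negating both swaps the roles
-- without changing the difference.
<ₚ⇒< : ∀ {f g} → f <ₚ g → f < g
<ₚ⇒< {f} {g} f<g with sign f | sign g
... | inj₁ -f>0 | inj₁ -g>0 =
  neg<neg -f>0 -g>0 (Equivalence.from (<⁺⇔<ₚ (_ , -g>0) (_ , -f>0))
    (Positive-resp-≈ (λ i → sym (neg-minus-neg f g i)) f<g))
... | inj₁ -f>0       | inj₂ (inj₁ g≈0) = neg<zero -f>0 g≈0
... | inj₁ -f>0       | inj₂ (inj₂ g>0) = neg<pos -f>0 g>0
... | inj₂ f≥0        | inj₁ -g>0       =
  contradiction f<g (nonNegative≮nonPositive {f} {g} f≥0 (inj₂ -g>0))
... | inj₂ f≥0        | inj₂ (inj₁ g≈0) =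
  contradiction f<g (nonNegative≮nonPositive {f} {g} f≥0 (inj₁ (neg-≈0 {g} g≈0)))
... | inj₂ (inj₁ f≈0) | inj₂ (inj₂ g>0) = zero<pos f≈0 g>0
... | inj₂ (inj₂ f>0) | inj₂ (inj₂ g>0) =
  pos<pos f>0 g>0 (Equivalence.from (<⁺⇔<ₚ (_ , f>0) (_ , g>0)) f<g)

<ₚ⇔< : ∀ f g → f <ₚ g ⇔ f < g
<ₚ⇔< f g = mk⇔ <ₚ⇒< <⇒<ₚ

-- Transfer of the order axioms; immediate neighbours

isStrictTotalOrder-resp-⇔ :
  ∀ {A : Set} {_≋_ _<₁_ _<₂_ : Rel A 0ℓ} → (∀ x y → x <₁ y ⇔ x <₂ y) →
  IsStrictTotalOrder _≋_ _<₁_ → IsStrictTotalOrder _≋_ _<₂_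
isStrictTotalOrder-resp-⇔ {A} {_≋_} {_<₁_} {_<₂_} eqv sto = isStrictTotalOrderᶜ record
  { isEquivalence = Sto.isEquivalence
  ; trans         = λ x<y y<z → to (Sto.trans (from x<y) (from y<z))
  ; compare       = cmp
  }
  where
  module Sto = IsStrictTotalOrder sto

  to : ∀ {x y} → x <₁ y → x <₂ y
  to = Equivalence.to (eqv _ _)

  from : ∀ {x y} → x <₂ y → x <₁ y
  from = Equivalence.from (eqv _ _)

  cmp : Trichotomous _≋_ _<₂_
  cmp x y with Sto.compare x y
  ... | tri< lt ne ngt = tri< (to lt) ne (ngt ∘ from)
  ... | tri≈ nlt e ngt = tri≈ (nlt ∘ from) e (ngt ∘ from)
  ... | tri> nlt ne gt = tri> (nlt ∘ from) ne (to gt)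

-- If h lay strictly between, discreteness would make h - f - 1 = h - g nonnegative, against h < g.
-- Phrasing the hypothesis by the difference serves successors and predecessors alike.
differ-by-one⇒immediateSuccessor : ∀ {f g} → g -ₚ f ≈ 1ₚ → IsImmediateSuccessor f g
differ-by-one⇒immediateSuccessor {f} {g} g-f≈1 =
  <ₚ⇒< (Positive-resp-≈ (λ i → sym (g-f≈1 i)) (∷-positive₀ (λ _ → refl) (ℤ.+<+ (s≤s z≤n)))) ,
  λ (h , f<h , h<g) →
    positive⇒¬nonNegative-neg (<⇒<ₚ h<g)
      (NonNegative-resp-≈ {(h -ₚ f) -ₚ 1ₚ} { -ₚ (g -ₚ h)} (h-f-1≈ h) (positive⇒nonNegative-pred (<⇒<ₚ f<h)))
  where
  identity : ∀ a b c → (c ℤ.- a) ℤ.- (b ℤ.- a) ≡ ℤ.- (b ℤ.- c)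
  identity = solve-∀

  h-f-1≈ : ∀ h → (h -ₚ f) -ₚ 1ₚ ≈ -ₚ (g -ₚ h)
  h-f-1≈ h i
    -- The hypothesis is used backwards, replacing 1 by `g -ₚ f`, so that `f` cancels.
    rewrite coeff--ₚ (h -ₚ f) 1ₚ i | sym (g-f≈1 i) | coeff--ₚ h f i | coeff--ₚ g f i
          | coeff-neg (g -ₚ h) i | coeff--ₚ g h i
    = identity (coeff f i) (coeff g i) (coeff h i)

theorem4 : IsStrictTotalOrder _≡_ _<ᴰ_
    × IsStrictTotalOrder _≈⁺_ _<⁺_
    × (∀ a b (a⁺ : Positive ⟦ a ⟧) (b⁺ : Positive ⟦ b ⟧) → a <ᴰ b ⇔ (⟦ a ⟧ , a⁺) <⁺ (⟦ b ⟧ , b⁺))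
    × IsStrictTotalOrder _≈_ _<_
    × (∀ a b → a <ᴰ b ⇔ ⟦ a ⟧ < ⟦ b ⟧)
    × (∀ (f g : ℤ[x]⁺) → f <⁺ g ⇔ proj₁ f < proj₁ g)
    × (∀ (bs cs : List Digit) → IsNumeral bs → IsNumeral cs → bs ≺ cs ⇔ [ bs ]ₓ < [ cs ]ₓ)
    × (∀ f → IsImmediateSuccessor f (f +ₚ 1ₚ) × IsImmediatePredecessor f (f -ₚ 1ₚ))
theorem4 =
    <ᴰ-isStrictTotalOrder
  , isStrictTotalOrder-resp-⇔ (λ f g → ⇔-sym (<⁺⇔<ₚ f g))
      -- The order on positive polynomials is pulled back along the map forgetting the positivity
      -- proof.
      (on-isStrictTotalOrder proj₁ <ₚ-isStrictTotalOrder)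
  , (λ a b a⁺ b⁺ → ⇔-sym (<⁺⇔<ₚ (⟦ a ⟧ , a⁺) (⟦ b ⟧ , b⁺)) ⇔-∘ <ᴰ⇔<ₚ a b)
  , isStrictTotalOrder-resp-⇔ <ₚ⇔< <ₚ-isStrictTotalOrder
  , (λ a b → <ₚ⇔< ⟦ a ⟧ ⟦ b ⟧ ⇔-∘ <ᴰ⇔<ₚ a b)
  , (λ f g → <ₚ⇔< (proj₁ f) (proj₁ g) ⇔-∘ <⁺⇔<ₚ f g)
  , (λ bs cs nbs ncs → <ₚ⇔< [ bs ]ₓ [ cs ]ₓ ⇔-∘ mk⇔ (≺⇒<ₚ nbs ncs) (<ₚ⇒≺ nbs ncs))
  , λ f → differ-by-one⇒immediateSuccessor {f} {f +ₚ 1ₚ} (add-one-minus f)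
        -- That `f -ₚ 1ₚ` immediately precedes `f` unfolds to `f` being its immediate successor.
        , differ-by-one⇒immediateSuccessor {f -ₚ 1ₚ} {f} (minus-minus-one f)
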